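{- For every integer $n\ge 0$, the $n$-th Thue-Morse word $t_n$ satisfies \[ \delta(t_n)= \begin{cases} 1 & \text{if } n=0,\\ 2 & \text{if } n=1,2,\\ \dfrac{10}{3+2^{4-n}} & \text{if } n\geq 3. \end{cases} \]
   Context: Strings are over the binary alphabet $\Sigma=\{\mathtt{a},\mathtt{b}\}$; $|w|$ denotes the length of $w$, and $\Sigma^k$ is the set of strings of length exactly $k$. For $w\in\Sigma^*$, $\overline{w}$ is the string obtained from $w$ by exchanging all $\mathtt{a}$'s and $\mathtt{b}$'s. Thue-Morse words: $t_0=\mathtt{a}$, and $t_n=t_{n-1}\overline{t_{n-1}}$ for $n>0$ (so $|t_n|=2^n$). A substring of $w$ is a string $y$ with $w=xyz$ for some strings $x,z\in\Sigma^*$; $\mathit{Substr}(w)$ denotes the set of substrings of $w$. The measure $\delta$ is defined by \[ \delta(w)=\max_{k=1,\ldots,|w|}\frac{|\Sigma^k\cap \mathit{Substr}(w)|}{k}, \] a maximum of rational numbers, where $|\Sigma^k\cap \mathit{Substr}(w)|$ is the number of distinct substrings of $w$ of length $k$. -}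

module Defs where

open import Data.Integer.Base using (ℤ; +_; -[1+_])
open import Data.List.Base
  using (List; []; _∷_; _++_; [_]; map; length; filter; upTo; cartesianProductWith)
open import Data.List.Relation.Binary.Infix.Heterogeneous
  using (Infix; MkView; toView; fromView)
open import Data.List.Relation.Binary.Infix.Heterogeneous.Properties using (infix?)
open import Data.List.Relation.Binary.Pointwise using (Pointwise-≡⇒≡; ≡⇒Pointwise-≡)
open import Data.Nat.Base as ℕ using (ℕ; zero; suc)
open import Data.Nat.Properties using (m^n≢0)
open import Data.Product.Base using (∃₂; _,_)
open import Data.Rational.Base using (ℚ; 0ℚ; _/_; _+_; Positive; NonZero)
open import Data.Rational.Properties
  using (≤-decTotalOrder; normalize-pos; pos+pos⇒pos; pos⇒nonZero)
open import Relation.Binary.Bundles using (DecTotalOrder)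
open import Data.List.Extrema (DecTotalOrder.totalOrder ≤-decTotalOrder) using (max)
open import Relation.Binary.Definitions using (DecidableEquality)
open import Relation.Binary.PropositionalEquality.Core using (_≡_; refl)
open import Relation.Nullary.Decidable using (Dec; yes; no; map′)

data Letter : Set where
  a b : Letter

String : Set
String = List Letter

_≟_ : DecidableEquality Letter
a ≟ a = yes refl
a ≟ b = no λ ()
b ≟ a = no λ ()
b ≟ b = yes refl

swap : Letter → Letter
swap a = b
swap b = a

complement : String → String
complement = map swap

t : ℕ → String
t zero    = [ a ]
t (suc n) = t n ++ complement (t n)

Substr : String → String → Set
Substr w y = ∃₂ λ x z → w ≡ x ++ y ++ z

substr? : ∀ w y → Dec (Substr w y)
substr? w y = map′ to from (infix? _≟_ y w)
  where
  to : Infix _≡_ y w → Substr w y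
  to i with MkView x p z ← toView i with refl ← Pointwise-≡⇒≡ p = x , z , refl

  from : Substr w y → Infix _≡_ y w
  from (x , z , refl) = fromView (MkView x (≡⇒Pointwise-≡ refl) z)

-- Each string of length k occurs exactly once, so that the length of a
-- filtered sublist is the cardinality of the corresponding subset.
Σ^ : ℕ → List String
Σ^ zero    = [ [] ]
Σ^ (suc k) = cartesianProductWith _∷_ (a ∷ b ∷ []) (Σ^ k)

#substr : String → ℕ → ℕ
#substr w k = length (filter (substr? w) (Σ^ k))

-- Here i = k - 1 ranges over 0, …, |w| - 1.  All the ratios are nonnegative,
-- so the default value 0 of max matters only for the empty string.
δ : String → ℚ
δ w = max 0ℚ (map (λ i → + #substr w (suc i) / suc i) (upTo (length w)))

infix 8 2^_

2^_ : ℤ → ℚ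
2^ (+ n)    = + (2 ℕ.^ n) / 1
2^ -[1+ n ] = (+ 1 / (2 ℕ.^ suc n)) {{m^n≢0 2 (suc n)}}

2^-positive : ∀ i → Positive (2^ i)
2^-positive (+ n)    = normalize-pos (2 ℕ.^ n) 1 {{_}} {{m^n≢0 2 n}}
2^-positive -[1+ n ] = normalize-pos 1 (2 ℕ.^ suc n) {{m^n≢0 2 (suc n)}}

3+2^-nonZero : ∀ i → NonZero (+ 3 / 1 + 2^ i)
3+2^-nonZero i =
  pos⇒nonZero (+ 3 / 1 + 2^ i) {{pos+pos⇒pos (+ 3 / 1) (2^ i) {{2^-positive i}}}}

{-# OPTIONS --safe #-}

-- With P n x the number of factors of t n of length x + 1, and M = 2^m, the
-- maximum for n = 4 + m is attained at length 3M + 1, where P n (3M) ≥ 10M.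
-- The word t (n + 1) is the image of t n under the morphism μ : c ↦ c c̄, so
-- each of its factors of length x + 1 is cut out of the image of a factor of
-- t n whose length is ⌊x/2⌋ + 1 or ⌈x/2⌉ + 1, according to the parity of its
-- position.  Hence P (n+1) x ≤ P n ⌊x/2⌋ + P n ⌈x/2⌉, and induction gives
-- P n x ≤ 10x/3 for x ≥ 2, P n x ≤ 2x + 4M for x ≤ 4M and P n x ≤ 16M - x;
-- they bound the ratio for x ≤ 3M, 3M ≤ x ≤ 4M and 4M ≤ x.  Conversely,
-- an odd-length factor of μ w determines both its position modulo 2 and the
-- factor of w it comes from, unless it is alternating, which is ruled out
-- because t n is cube-free on letters; so P (n+1) (2j) ≥ 2 P n j for j ≥ 3.
module Submission where

open import Defs
open import Data.Integer.Base using (+_; _-_)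
open import Data.Nat.Base using (ℕ; _≥_)
open import Data.Product.Base using (_×_)
open import Data.Rational.Base using (_/_; _+_; _÷_)
open import Data.Sum.Base using (_⊎_)
open import Relation.Binary.PropositionalEquality.Core using (_≡_)

import Data.Integer.Base as ℤ
import Data.Integer.Properties as ℤₚ
open import Data.List.Base
open import Data.List.Membership.Propositional using (_∈_; lose)
open import Data.List.Membership.Propositional.Properties
open import Data.List.Properties
  using (++-assoc; ++-identityʳ; length-++; length-map; length-filter; ∷-injective)
open import Data.List.Relation.Binary.Disjoint.Propositional using (Disjoint)
open import Data.List.Relation.Binary.Permutation.Propositional.Properties
  using (∈-resp-↭; ↭-length; shift)
open import Data.List.Relation.Binary.Subset.Propositional using (_⊆_)
open import Data.List.Relation.Unary.All as All using (All)
import Data.List.Relation.Unary.All.Properties as All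
open import Data.List.Relation.Unary.AllPairs using ([]; _∷_)
open import Data.List.Relation.Unary.Any using (here; there)
import Data.List.Relation.Unary.Any.Properties as Any
open import Data.List.Relation.Unary.Unique.Propositional using (Unique)
import Data.List.Relation.Unary.Unique.Propositional.Properties as Unique
import Data.Nat.Base as ℕ
open import Data.Nat.Base using (zero; suc; _≤_; _<_; z≤n; s≤s; ⌊_/2⌋; ⌈_/2⌉)
open import Data.Nat.Properties
open import Data.Nat.Tactic.RingSolver using (solve-∀)
open import Data.Product.Base using (∃; ∃₂; _,_; proj₁; proj₂)
import Data.Rational.Base as ℚ
import Data.Rational.Properties as ℚₚ
import Data.Rational.Unnormalised.Base as ℚᵘ
import Data.Rational.Unnormalised.Properties as ℚᵘₚ
open import Data.Sum.Base using (inj₁; inj₂)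
open import Function.Base using (_∘_)
open import Relation.Binary.Bundles using (DecTotalOrder)
open import Relation.Binary.PropositionalEquality
  using (refl; sym; trans; cong; cong₂; subst; subst₂; _≢_; module ≡-Reasoning)
open import Relation.Nullary using (¬_; contradiction; yes; no)

open import Data.List.Extrema (DecTotalOrder.totalOrder ℚₚ.≤-decTotalOrder)
  using (max≤v⁺; v≤max⁺)

-- Counting substrings with duplicate-free lists.

unique-⊆⇒length-≤ : ∀ {A : Set} {xs ys : List A} →
  Unique xs → xs ⊆ ys → length xs ≤ length ys
unique-⊆⇒length-≤ []        _     = z≤n
unique-⊆⇒length-≤ {xs = x ∷ xs} (x≢ ∷ u) xs⊆ys
  with ys₁ , ys₂ , refl ← ∈-∃++ (xs⊆ys (here refl)) =
  ≤-trans (s≤s (unique-⊆⇒length-≤ u xs⊆))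
          (≤-reflexive (sym (↭-length (shift x ys₁ ys₂))))
  where
  -- Deleting one occurrence of `x` from `ys` loses no element of `xs`, because `x` does not recur
  -- there.
  xs⊆ : xs ⊆ ys₁ ++ ys₂
  xs⊆ {y} y∈xs with ∈-resp-↭ (shift x ys₁ ys₂) (xs⊆ys (there y∈xs))
  ... | here y≡x = contradiction (sym y≡x) (All.lookup x≢ y∈xs)
  ... | there y∈ = y∈

∈-Σ^⁺ : ∀ y → y ∈ Σ^ (length y)
∈-Σ^⁺ []      = here refl
∈-Σ^⁺ (c ∷ y) = ∈-cartesianProductWith⁺ _∷_ (letter c) (∈-Σ^⁺ y)
  where
  letter : ∀ c → c ∈ a ∷ b ∷ []
  letter a = here refl
  letter b = there (here refl)

∈-Σ^⁻ : ∀ k {y} → y ∈ Σ^ k → length y ≡ k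
∈-Σ^⁻ zero    (here refl) = refl
∈-Σ^⁻ (suc k) y∈
  with _ , _ , _ , y′∈ , refl ← ∈-cartesianProductWith⁻ _∷_ (a ∷ b ∷ []) (Σ^ k) y∈ =
  cong suc (∈-Σ^⁻ k y′∈)

Σ^-unique : ∀ k → Unique (Σ^ k)
Σ^-unique zero    = All.[] ∷ []
Σ^-unique (suc k) = Unique.cartesianProductWith⁺ _∷_ ∷-injective
  (((λ ()) All.∷ All.[]) ∷ All.[] ∷ []) (Σ^-unique k)

substrs : String → ℕ → List String
substrs w k = filter (substr? w) (Σ^ k)

∈-substrs⁺ : ∀ {w y k} → Substr w y → length y ≡ k → y ∈ substrs w k
∈-substrs⁺ {w} {y} s refl = ∈-filter⁺ (substr? w) (∈-Σ^⁺ y) s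

∈-substrs⁻ : ∀ {w y} k → y ∈ substrs w k → Substr w y × length y ≡ k
∈-substrs⁻ {w} k y∈ with y∈Σ , s ← ∈-filter⁻ (substr? w) {xs = Σ^ k} y∈ = s , ∈-Σ^⁻ k y∈Σ

substrs-unique : ∀ w k → Unique (substrs w k)
substrs-unique w k = Unique.filter⁺ (substr? w) (Σ^-unique k)

-- `L` may contain repetitions, so an upper bound only needs a complete list of candidates; the
-- lower bound below needs distinct ones.
#substr-≤-length : ∀ {w k L} →
  (∀ {y} → Substr w y → length y ≡ k → y ∈ L) → #substr w k ≤ length L
#substr-≤-length {w} {k} all∈L = unique-⊆⇒length-≤ (substrs-unique w k)
  λ y∈ → let s , eq = ∈-substrs⁻ k y∈ in all∈L s eq

length-≤-#substr : ∀ {w k L} → Unique L →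
  (∀ {y} → y ∈ L → Substr w y × length y ≡ k) → length L ≤ #substr w k
length-≤-#substr u sound = unique-⊆⇒length-≤ u
  λ y∈ → let s , eq = sound y∈ in ∈-substrs⁺ s eq

#substr-≤-2^ : ∀ w k → #substr w k ≤ length (Σ^ k)
#substr-≤-2^ w k = length-filter (substr? w) (Σ^ k)

Substr-trans : ∀ {w y z} → Substr w y → Substr y z → Substr w z
Substr-trans {z = z} (x₁ , x₂ , refl) (y₁ , y₂ , refl) = x₁ ++ y₁ , y₂ ++ x₂ , (begin
  x₁ ++ (y₁ ++ z ++ y₂) ++ x₂    ≡⟨ cong (x₁ ++_) (++-assoc y₁ _ x₂) ⟩
  x₁ ++ y₁ ++ (z ++ y₂) ++ x₂    ≡⟨ cong (λ v → x₁ ++ y₁ ++ v) (++-assoc z y₂ x₂) ⟩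
  x₁ ++ y₁ ++ z ++ y₂ ++ x₂      ≡⟨ ++-assoc x₁ y₁ _ ⟨
  (x₁ ++ y₁) ++ z ++ y₂ ++ x₂    ∎)
  where open ≡-Reasoning

Substr-∷ : ∀ {w y} c → Substr w y → Substr (c ∷ w) y
Substr-∷ c (x , z , eq) = c ∷ x , z , cong (c ∷_) eq

-- The morphism `μ` and the Thue-Morse words.

μ : String → String
μ []      = []
μ (c ∷ w) = c ∷ swap c ∷ μ w

swap-involutive : ∀ c → swap (swap c) ≡ c
swap-involutive a = refl
swap-involutive b = refl

swap-injective : ∀ {c d} → swap c ≡ swap d → c ≡ d
swap-injective {c} {d} eq =
  trans (sym (swap-involutive c)) (trans (cong swap eq) (swap-involutive d))

c≢swap-c : ∀ c → c ≢ swap c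
c≢swap-c a ()
c≢swap-c b ()

μ-++ : ∀ u v → μ (u ++ v) ≡ μ u ++ μ v
μ-++ []      v = refl
μ-++ (c ∷ u) v = cong (λ w → c ∷ swap c ∷ w) (μ-++ u v)

μ-complement : ∀ w → μ (complement w) ≡ complement (μ w)
μ-complement []      = refl
μ-complement (c ∷ w) = cong (λ w → swap c ∷ swap (swap c) ∷ w) (μ-complement w)

μ-injective : ∀ {u v} → μ u ≡ μ v → u ≡ v
μ-injective {[]}    {[]}    _  = refl
μ-injective {_ ∷ _} {_ ∷ _} eq with refl , eq′ ← ∷-injective eq =
  cong (_ ∷_) (μ-injective (proj₂ (∷-injective eq′)))

length-μ : ∀ w → length (μ w) ≡ length w ℕ.+ length w
length-μ []      = refl
length-μ (c ∷ w) = cong suc (trans (cong suc (length-μ w)) (sym (+-suc _ _)))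

Substr-μ : ∀ {w u} → Substr w u → Substr (μ w) (μ u)
Substr-μ {u = u} (x , z , refl) =
  μ x , μ z , trans (μ-++ x (u ++ z)) (cong (μ x ++_) (μ-++ u z))

-- The definition of `t` doubles the word globally, `μ` doubles it letter by letter; the two agree
-- since `μ` commutes with complement and concatenation.
t-suc : ∀ n → t (suc n) ≡ μ (t n)
t-suc zero    = refl
t-suc (suc n) = begin
  t (suc n) ++ complement (t (suc n))  ≡⟨ cong (λ w → w ++ complement w) (t-suc n) ⟩
  μ (t n) ++ complement (μ (t n))      ≡⟨ cong (μ (t n) ++_) (μ-complement (t n)) ⟨
  μ (t n) ++ μ (complement (t n))      ≡⟨ μ-++ (t n) _ ⟨
  μ (t n ++ complement (t n))          ∎
  where open ≡-Reasoning

length-t : ∀ n → length (t n) ≡ 2 ℕ.^ n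
length-t zero    = refl
length-t (suc n) = begin
  length (t n ++ complement (t n))             ≡⟨ length-++ (t n) ⟩
  length (t n) ℕ.+ length (complement (t n))   ≡⟨ cong (length (t n) ℕ.+_) (length-map swap (t n)) ⟩
  length (t n) ℕ.+ length (t n)                ≡⟨ cong (λ k → k ℕ.+ k) (length-t n) ⟩
  2 ℕ.^ n ℕ.+ 2 ℕ.^ n                          ≡⟨ cong (2 ℕ.^ n ℕ.+_) (+-identityʳ _) ⟨
  2 ℕ.^ suc n                                  ∎
  where open ≡-Reasoning

-- Desubstitution and the upper recurrence.

desubstitute-prefix : ∀ w y {z} → μ w ≡ y ++ z →
  ∃₂ λ u v → w ≡ u ++ v × length u ≡ ⌈ length y /2⌉ × take (length y) (μ u) ≡ y
desubstitute-prefix w       []      eq = [] , w , refl , refl , refl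
-- A prefix of odd length ends inside a block, whose first letter determines the whole block; hence
-- the rounding up, and the `take` that removes the surplus letter.
desubstitute-prefix (c ∷ w) (d ∷ []) eq with refl , _ ← ∷-injective eq =
  c ∷ [] , w , refl , refl , refl
desubstitute-prefix (c ∷ w) (d ∷ e ∷ y) eq
  with refl , eq₁ ← ∷-injective eq
  with refl , eq₂ ← ∷-injective eq₁
  with u , v , w≡ , len , tk ← desubstitute-prefix w y eq₂ =
  c ∷ u , v , cong (c ∷_) w≡ , cong suc len , cong (λ y → c ∷ swap c ∷ y) tk

CutFrom : String → ℕ → (String → String) → String → Set
CutFrom w k cut y = ∃ λ u → Substr w u × length u ≡ k × cut u ≡ y

CutFrom-∷ : ∀ {w k cut y} c → CutFrom w k cut y → CutFrom (c ∷ w) k cut y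
CutFrom-∷ c (u , s , rest) = u , Substr-∷ c s , rest

-- An occurrence at an even position starts with a full block, and x + 1 letters meet ⌈(x+1)/2⌉ =
-- ⌊x/2⌋ + 1 blocks. At an odd position `d` is the second letter of a block, and the remaining x
-- letters meet ⌈x/2⌉ further blocks.
desubstitute : ∀ w d y → Substr (μ w) (d ∷ y) → let x = length y in
  CutFrom w (suc ⌊ x /2⌋) (take (suc x) ∘ μ) (d ∷ y) ⊎
  CutFrom w (suc ⌈ x /2⌉) (take (suc x) ∘ drop 1 ∘ μ) (d ∷ y)
desubstitute w d y ([] , z , eq)
  with u , v , w≡ , len , tk ← desubstitute-prefix w (d ∷ y) eq =
  inj₁ (u , ([] , v , w≡) , len , tk)
desubstitute (c ∷ w) d y (e ∷ [] , z , eq)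
  with refl , eq₁ ← ∷-injective eq
  with refl , eq₂ ← ∷-injective eq₁
  with u , v , w≡ , len , tk ← desubstitute-prefix w y eq₂ =
  inj₂ (c ∷ u , ([] , v , cong (c ∷_) w≡) , cong suc len , cong (swap c ∷_) tk)
desubstitute (c ∷ w) d y (e ∷ f ∷ x , z , eq)
  with refl , eq₁ ← ∷-injective eq
  with refl , eq₂ ← ∷-injective eq₁
  with desubstitute w d y (x , z , eq₂)
... | inj₁ cut = inj₁ (CutFrom-∷ c cut)
... | inj₂ cut = inj₂ (CutFrom-∷ c cut)

#substr-μ-≤ : ∀ w x →
  #substr (μ w) (suc x) ≤ #substr w (suc ⌊ x /2⌋) ℕ.+ #substr w (suc ⌈ x /2⌉)
#substr-μ-≤ w x = subst (#substr (μ w) (suc x) ≤_) length-L (#substr-≤-length complete)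
  where
  cut₀ cut₁ : String → String
  cut₀ = take (suc x) ∘ μ
  cut₁ = take (suc x) ∘ drop 1 ∘ μ

  F₀ F₁ : List String
  F₀ = substrs w (suc ⌊ x /2⌋)
  F₁ = substrs w (suc ⌈ x /2⌉)

  length-L : length (map cut₀ F₀ ++ map cut₁ F₁) ≡ length F₀ ℕ.+ length F₁
  length-L = trans (length-++ (map cut₀ F₀))
    (cong₂ ℕ._+_ (length-map cut₀ F₀) (length-map cut₁ F₁))

  complete : ∀ {y} → Substr (μ w) y → length y ≡ suc x → y ∈ map cut₀ F₀ ++ map cut₁ F₁
  complete {d ∷ y} s refl with desubstitute w d y s
  ... | inj₁ (u , su , len , eq) = ∈-++⁺ˡ
          (subst (_∈ map cut₀ F₀) eq (∈-map⁺ cut₀ (∈-substrs⁺ su len)))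
  ... | inj₂ (u , su , len , eq) = ∈-++⁺ʳ (map cut₀ F₀)
          (subst (_∈ map cut₁ F₁) eq (∈-map⁺ cut₁ (∈-substrs⁺ su len)))

-- Absence of cubes of letters.

CubeFree : String → Set
CubeFree w = ∀ c → ¬ Substr w (c ∷ c ∷ c ∷ [])

-- Any three consecutive letters of an image contain a complete block, and its two letters differ.
μ-cubeFree : ∀ w → CubeFree (μ w)
μ-cubeFree (d ∷ w) _ ([] , z , eq)
  with refl , eq₁ ← ∷-injective eq = c≢swap-c d (sym (proj₁ (∷-injective eq₁)))
μ-cubeFree (_ ∷ d ∷ w) _ (_ ∷ [] , z , eq)
  with _ , eq₁ ← ∷-injective eq
  with _ , eq₂ ← ∷-injective eq₁
  with refl , eq₃ ← ∷-injective eq₂ = c≢swap-c d (sym (proj₁ (∷-injective eq₃)))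
μ-cubeFree (d ∷ w) c (_ ∷ _ ∷ x , z , eq) =
  μ-cubeFree w c (x , z , proj₂ (∷-injective (proj₂ (∷-injective eq))))

t-cubeFree : ∀ n → CubeFree (t n)
t-cubeFree zero _ ([] , _ , ())
t-cubeFree zero _ (_ ∷ [] , _ , ())
t-cubeFree zero _ (_ ∷ _ ∷ _ , _ , ())
t-cubeFree (suc n) = subst CubeFree (sym (t-suc n)) (μ-cubeFree (t n))

#substr-3-≤ : ∀ {w} → CubeFree w → #substr w 3 ≤ 6
#substr-3-≤ {w} cf = #substr-≤-length {L = L} complete
  where
  L : List String
  L = (a ∷ a ∷ b ∷ []) ∷ (a ∷ b ∷ a ∷ []) ∷ (a ∷ b ∷ b ∷ []) ∷
      (b ∷ a ∷ a ∷ []) ∷ (b ∷ a ∷ b ∷ []) ∷ (b ∷ b ∷ a ∷ []) ∷ []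

  complete : ∀ {y} → Substr w y → length y ≡ 3 → y ∈ L
  complete {a ∷ a ∷ a ∷ []} s refl = contradiction s (cf _)
  complete {a ∷ a ∷ b ∷ []} s refl = here refl
  complete {a ∷ b ∷ a ∷ []} s refl = there (here refl)
  complete {a ∷ b ∷ b ∷ []} s refl = there (there (here refl))
  complete {b ∷ a ∷ a ∷ []} s refl = there (there (there (here refl)))
  complete {b ∷ a ∷ b ∷ []} s refl = there (there (there (there (here refl))))
  complete {b ∷ b ∷ a ∷ []} s refl = there (there (there (there (there (here refl)))))
  complete {b ∷ b ∷ b ∷ []} s refl = contradiction s (cf _)

-- Factors of odd length and the lower recurrence.

tail-μ : String → String
tail-μ = drop 1 ∘ μ

init-μ : String → String
init-μ []              = []
init-μ (c ∷ [])        = c ∷ []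
init-μ (c ∷ u@(_ ∷ _)) = c ∷ swap c ∷ init-μ u

-- The first block keeps only its second letter, and complementing that letter recovers the lost
-- one.
tail-μ-injective : ∀ {u v} → tail-μ u ≡ tail-μ v → u ≡ v
tail-μ-injective {[]}    {[]}    _  = refl
tail-μ-injective {_ ∷ _} {_ ∷ _} eq with eq₁ , eq₂ ← ∷-injective eq =
  cong₂ _∷_ (swap-injective eq₁) (μ-injective eq₂)

evens : String → String
evens []          = []
evens (c ∷ [])    = c ∷ []
evens (c ∷ _ ∷ w) = c ∷ evens w

-- The even positions hold the first letters of the blocks, and dropping the second letter of the
-- last block loses none of them.
evens-init-μ : ∀ u → evens (init-μ u) ≡ u
evens-init-μ []              = refl
evens-init-μ (c ∷ [])        = refl
evens-init-μ (c ∷ u@(_ ∷ _)) = cong (c ∷_) (evens-init-μ u)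

init-μ-injective : ∀ {u v} → init-μ u ≡ init-μ v → u ≡ v
init-μ-injective {u} {v} eq =
  trans (sym (evens-init-μ u)) (trans (cong evens eq) (evens-init-μ v))

length-tail-μ : ∀ u {j} → length u ≡ suc j → length (tail-μ u) ≡ suc (j ℕ.+ j)
length-tail-μ (c ∷ u) refl = cong suc (length-μ u)

length-init-μ : ∀ u {j} → length u ≡ suc j → length (init-μ u) ≡ suc (j ℕ.+ j)
length-init-μ (c ∷ [])        refl = refl
length-init-μ (c ∷ u@(_ ∷ u′)) refl =
  cong suc (trans (cong suc (length-init-μ u refl)) (sym (+-suc (suc (length u′)) _)))

Substr-tail-μ : ∀ {w u} → Substr w u → Substr (μ w) (tail-μ u)
Substr-tail-μ {u = []}    s = Substr-μ s
Substr-tail-μ {u = c ∷ u} s = Substr-trans (Substr-μ s)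
  (c ∷ [] , [] , cong (λ v → c ∷ swap c ∷ v) (sym (++-identityʳ (μ u))))

μ≡init-μ++ : ∀ u → ∃ λ z → μ u ≡ init-μ u ++ z
μ≡init-μ++ []              = [] , refl
μ≡init-μ++ (c ∷ [])        = swap c ∷ [] , refl
μ≡init-μ++ (c ∷ u@(_ ∷ _)) with z , eq ← μ≡init-μ++ u = z , cong (λ v → c ∷ swap c ∷ v) eq

Substr-init-μ : ∀ {w u} → Substr w u → Substr (μ w) (init-μ u)
Substr-init-μ {u = u} s with z , eq ← μ≡init-μ++ u = Substr-trans (Substr-μ s) ([] , z , eq)

-- An equality between the two cuts makes the word alternating: reading it as
-- c̄ e₁ ē₁ e₂ ē₂ e₃ … = d₀ d̄₀ d₁ d̄₁ d₂ d̄₂ … gives e₁ = e₂ = e₃.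
tail-μ≢init-μ : ∀ {u v} → 4 ≤ length u → CubeFree u →
  tail-μ u ≢ init-μ v
tail-μ≢init-μ {_ ∷ []}         (s≤s ())
tail-μ≢init-μ {_ ∷ _ ∷ []}     (s≤s (s≤s ()))
tail-μ≢init-μ {_ ∷ _ ∷ _ ∷ []} (s≤s (s≤s (s≤s ())))
tail-μ≢init-μ {c ∷ e₁ ∷ e₂ ∷ e₃ ∷ u} {v} _ cf = go v
  where
  step : ∀ {e e′ d} → swap e ≡ d → e′ ≡ swap d → e′ ≡ e
  step {e} refl eq = trans eq (swap-involutive e)

  go : ∀ v → tail-μ (c ∷ e₁ ∷ e₂ ∷ e₃ ∷ u) ≢ init-μ v
  go []                    ()
  go (_ ∷ [])              ()
  go (_ ∷ _ ∷ [])          ()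
  go (_ ∷ _ ∷ _ ∷ [])      ()
  go (d₀ ∷ d₁ ∷ d₂ ∷ d₃ ∷ v) eq
    with _  , eq  ← ∷-injective eq
    with _  , eq  ← ∷-injective eq
    with p₁ , eq  ← ∷-injective eq
    with q₁ , eq  ← ∷-injective eq
    with p₂ , eq  ← ∷-injective eq
    with q₂ , _   ← ∷-injective eq
    with refl ← step {e₁} {e₂} p₁ q₁
    with refl ← step {e₂} {e₃} p₂ q₂ = cf _ (c ∷ [] , u , refl)

-- Both cuts are injective and their images are disjoint, so each factor of length j + 1 contributes
-- two of length 2j + 1. The bound `3 ≤ j` supplies the four letters from which disjointness
-- extracts a cube.
#substr-μ-≥ : ∀ {w j} → CubeFree w → 3 ≤ j →
  #substr w (suc j) ℕ.+ #substr w (suc j) ≤ #substr (μ w) (suc (j ℕ.+ j))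
#substr-μ-≥ {w} {j} cf 3≤j =
  subst (_≤ #substr (μ w) (suc (j ℕ.+ j))) length-L (length-≤-#substr unique sound)
  where
  F : List String
  F = substrs w (suc j)

  length-L : length (map tail-μ F ++ map init-μ F) ≡ length F ℕ.+ length F
  length-L = trans (length-++ (map tail-μ F))
    (cong₂ ℕ._+_ (length-map tail-μ F) (length-map init-μ F))

  disjoint : Disjoint (map tail-μ F) (map init-μ F)
  disjoint (y∈₁ , y∈₂)
    with u , u∈ , refl ← ∈-map⁻ tail-μ y∈₁
    with v , _ , eq ← ∈-map⁻ init-μ y∈₂
    with s , len ← ∈-substrs⁻ (suc j) u∈ =
    tail-μ≢init-μ (subst (4 ≤_) (sym len) (s≤s 3≤j)) (λ c → cf c ∘ Substr-trans s) eq

  unique : Unique (map tail-μ F ++ map init-μ F)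
  unique = Unique.++⁺ (Unique.map⁺ tail-μ-injective (substrs-unique w (suc j)))
                      (Unique.map⁺ init-μ-injective (substrs-unique w (suc j))) disjoint

  sound : ∀ {y} → y ∈ map tail-μ F ++ map init-μ F →
          Substr (μ w) y × length y ≡ suc (j ℕ.+ j)
  sound y∈ with ∈-++⁻ (map tail-μ F) y∈
  ... | inj₁ y∈₁ with u , u∈ , refl ← ∈-map⁻ tail-μ y∈₁
                 with s , len ← ∈-substrs⁻ (suc j) u∈ =
        Substr-tail-μ s , length-tail-μ u len
  ... | inj₂ y∈₂ with u , u∈ , refl ← ∈-map⁻ init-μ y∈₂
                 with s , len ← ∈-substrs⁻ (suc j) u∈ =
        Substr-init-μ s , length-init-μ u len

-- Recurrences and bounds for the factor counts.

P : ℕ → ℕ → ℕ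
P n x = #substr (t n) (suc x)

-- Because `P` is indexed by length minus one, the two halves add up to exactly x, so bounds linear
-- in x pass through the recurrence.
P-suc-≤ : ∀ n x → P (suc n) x ≤ P n ⌊ x /2⌋ ℕ.+ P n ⌈ x /2⌉
P-suc-≤ n x rewrite t-suc n = #substr-μ-≤ (t n) x

P-double-≥ : ∀ n {j} → 3 ≤ j → P n j ℕ.+ P n j ≤ P (suc n) (j ℕ.+ j)
P-double-≥ n 3≤j rewrite t-suc n = #substr-μ-≥ (t-cubeFree n) 3≤j

P-0-≤ : ∀ n → P n 0 ≤ 2
P-0-≤ n = #substr-≤-2^ (t n) 1

P-1-≤ : ∀ n → P n 1 ≤ 4
P-1-≤ n = #substr-≤-2^ (t n) 2

P-2-≤ : ∀ n → P n 2 ≤ 6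
P-2-≤ n = #substr-3-≤ (t-cubeFree n)

⌈/2⌉-≤ : ∀ {x} N → x ≤ 2 ℕ.* N → ⌈ x /2⌉ ≤ N
⌈/2⌉-≤ {x} N x≤ = begin
  ⌈ x /2⌉            ≤⟨ ⌈n/2⌉-mono x≤ ⟩
  ⌈ N ℕ.+ (N ℕ.+ 0) /2⌉  ≡⟨ cong (λ k → ⌈ N ℕ.+ k /2⌉) (+-identityʳ N) ⟩
  ⌈ N ℕ.+ N /2⌉      ≡⟨ n≡⌈n+n/2⌉ N ⟨
  N                  ∎
  where open ≤-Reasoning

⌊/2⌋-≤ : ∀ {x} N → x ≤ 2 ℕ.* N → ⌊ x /2⌋ ≤ N
⌊/2⌋-≤ {x} N x≤ = ≤-trans (⌊n/2⌋≤⌈n/2⌉ x) (⌈/2⌉-≤ N x≤)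

-- This is the number of positions at which a factor of length x + 1 can start in a word of length
-- 2^n; the bounds for the two halves add up to the one for x.
P+x≤2^n : ∀ n x → x ≤ 2 ℕ.^ n → P n x ℕ.+ x ≤ 2 ℕ.^ n
P+x≤2^n zero    zero          _ = s≤s z≤n
P+x≤2^n zero    (suc zero)    _ = s≤s z≤n
P+x≤2^n zero    (suc (suc _)) (s≤s ())
P+x≤2^n (suc n) x x≤ = begin
  P (suc n) x ℕ.+ x                ≤⟨ +-monoˡ-≤ x (P-suc-≤ n x) ⟩
  P n l ℕ.+ P n r ℕ.+ x            ≡⟨ cong (P n l ℕ.+ P n r ℕ.+_) (⌊n/2⌋+⌈n/2⌉≡n x) ⟨
  P n l ℕ.+ P n r ℕ.+ (l ℕ.+ r)    ≡⟨ regroup (P n l) (P n r) l r ⟩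
  (P n l ℕ.+ l) ℕ.+ (P n r ℕ.+ r)  ≤⟨ +-mono-≤ (P+x≤2^n n l (⌊/2⌋-≤ _ x≤))
                                                (P+x≤2^n n r (⌈/2⌉-≤ _ x≤)) ⟩
  2 ℕ.^ n ℕ.+ 2 ℕ.^ n              ≡⟨ cong (2 ℕ.^ n ℕ.+_) (+-identityʳ _) ⟨
  2 ℕ.^ suc n                      ∎
  where
  open ≤-Reasoning
  l = ⌊ x /2⌋
  r = ⌈ x /2⌉

  regroup : ∀ p q l r → p ℕ.+ q ℕ.+ (l ℕ.+ r) ≡ (p ℕ.+ l) ℕ.+ (q ℕ.+ r)
  regroup = solve-∀

-- The bound can fail at x = 1, where `P` may be 4. From x = 4 on both halves are at least 2 and the
-- induction applies.
3P≤10x : ∀ n x → 2 ≤ x → x ≤ 2 ℕ.^ n → 3 ℕ.* P n x ≤ 10 ℕ.* x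
3P≤10x zero    x 2≤x x≤ = contradiction (≤-trans 2≤x x≤) λ { (s≤s ()) }
3P≤10x (suc n) (suc zero) (s≤s ())
3P≤10x n (suc (suc zero)) _ _ = ≤-trans (*-monoʳ-≤ 3 (P-2-≤ n)) (m≤m+n 18 2)
-- One half of 3 is 1, so the counts 4 and 6 are used directly; 3 · (4 + 6) = 10 · 3 is an equality.
3P≤10x (suc n) (suc (suc (suc zero))) _ _ =
  *-monoʳ-≤ 3 (≤-trans (P-suc-≤ n 3) (+-mono-≤ (P-1-≤ n) (P-2-≤ n)))
3P≤10x (suc n) x@(suc (suc (suc (suc x′)))) _ x≤ = begin
  3 ℕ.* P (suc n) x              ≤⟨ *-monoʳ-≤ 3 (P-suc-≤ n x) ⟩
  3 ℕ.* (P n l ℕ.+ P n r)        ≡⟨ *-distribˡ-+ 3 (P n l) (P n r) ⟩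
  3 ℕ.* P n l ℕ.+ 3 ℕ.* P n r    ≤⟨ +-mono-≤ (3P≤10x n l (s≤s (s≤s z≤n)) (⌊/2⌋-≤ _ x≤))
                                             (3P≤10x n r (s≤s (s≤s z≤n)) (⌈/2⌉-≤ _ x≤)) ⟩
  10 ℕ.* l ℕ.+ 10 ℕ.* r          ≡⟨ *-distribˡ-+ 10 l r ⟨
  10 ℕ.* (l ℕ.+ r)               ≡⟨ cong (10 ℕ.*_) (⌊n/2⌋+⌈n/2⌉≡n x) ⟩
  10 ℕ.* x                       ∎
  where
  open ≤-Reasoning
  l = ⌊ x /2⌋
  r = ⌈ x /2⌉

-- Adding the bounds for the halves keeps the slope 2 and doubles the constant, as M doubles. The
-- base case evaluates the counts for `t 4`. At x = 3M the bound is 10M, matching both 10x/3 and the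
-- lower bound below.
P≤2x+4·2^m : ∀ m x → x ≤ 4 ℕ.* 2 ℕ.^ m → P (4 ℕ.+ m) x ≤ 2 ℕ.* x ℕ.+ 4 ℕ.* 2 ℕ.^ m
P≤2x+4·2^m zero 0 _ = ≤ᵇ⇒≤ (P 4 0) 4 _
P≤2x+4·2^m zero 1 _ = ≤ᵇ⇒≤ (P 4 1) 6 _
P≤2x+4·2^m zero 2 _ = ≤ᵇ⇒≤ (P 4 2) 8 _
P≤2x+4·2^m zero 3 _ = ≤ᵇ⇒≤ (P 4 3) 10 _
P≤2x+4·2^m zero 4 _ = ≤ᵇ⇒≤ (P 4 4) 12 _
P≤2x+4·2^m zero (suc (suc (suc (suc (suc _))))) (s≤s (s≤s (s≤s (s≤s ()))))
P≤2x+4·2^m (suc m) x x≤ = begin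
  P (4 ℕ.+ suc m) x                                       ≤⟨ P-suc-≤ (4 ℕ.+ m) x ⟩
  P (4 ℕ.+ m) l ℕ.+ P (4 ℕ.+ m) r                         ≤⟨ +-mono-≤ (P≤2x+4·2^m m l (⌊/2⌋-≤ _ x≤′))
                                                                     (P≤2x+4·2^m m r (⌈/2⌉-≤ _ x≤′)) ⟩
  (2 ℕ.* l ℕ.+ 4 ℕ.* M) ℕ.+ (2 ℕ.* r ℕ.+ 4 ℕ.* M)         ≡⟨ regroup l r M ⟩
  2 ℕ.* (l ℕ.+ r) ℕ.+ 4 ℕ.* (2 ℕ.* M)                     ≡⟨ cong (λ y → 2 ℕ.* y ℕ.+ 4 ℕ.* (2 ℕ.* M)) (⌊n/2⌋+⌈n/2⌉≡n x) ⟩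
  2 ℕ.* x ℕ.+ 4 ℕ.* (2 ℕ.* M)                             ∎
  where
  open ≤-Reasoning
  l = ⌊ x /2⌋
  r = ⌈ x /2⌉
  M = 2 ℕ.^ m

  4*2*≡2*4* : ∀ M → 4 ℕ.* (2 ℕ.* M) ≡ 2 ℕ.* (4 ℕ.* M)
  4*2*≡2*4* = solve-∀

  x≤′ : x ≤ 2 ℕ.* (4 ℕ.* M)
  x≤′ = ≤-trans x≤ (≤-reflexive (4*2*≡2*4* M))

  regroup : ∀ l r M → (2 ℕ.* l ℕ.+ 4 ℕ.* M) ℕ.+ (2 ℕ.* r ℕ.+ 4 ℕ.* M)
                    ≡ 2 ℕ.* (l ℕ.+ r) ℕ.+ 4 ℕ.* (2 ℕ.* M)
  regroup = solve-∀

-- The word `t 4` has ten factors of length 4. Each doubling step sends 3M to 6M and stays within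
-- the range j ≥ 3 of the lower recurrence.
10·2^m≤P : ∀ m → 10 ℕ.* 2 ℕ.^ m ≤ P (4 ℕ.+ m) (3 ℕ.* 2 ℕ.^ m)
10·2^m≤P zero    = ≤ᵇ⇒≤ 10 (P 4 3) _
10·2^m≤P (suc m) = begin
  10 ℕ.* (2 ℕ.* M)                      ≡⟨ double 10 M ⟩
  10 ℕ.* M ℕ.+ 10 ℕ.* M                 ≤⟨ +-mono-≤ (10·2^m≤P m) (10·2^m≤P m) ⟩
  P (4 ℕ.+ m) (3 ℕ.* M) ℕ.+ P (4 ℕ.+ m) (3 ℕ.* M)
                                        ≤⟨ P-double-≥ (4 ℕ.+ m) (*-monoʳ-≤ 3 (m^n>0 2 m)) ⟩
  P (5 ℕ.+ m) (3 ℕ.* M ℕ.+ 3 ℕ.* M)     ≡⟨ cong (P (5 ℕ.+ m)) (double 3 M) ⟨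
  P (5 ℕ.+ m) (3 ℕ.* (2 ℕ.* M))         ∎
  where
  open ≤-Reasoning
  M = 2 ℕ.^ m

  double : ∀ k M → k ℕ.* (2 ℕ.* M) ≡ k ℕ.* M ℕ.+ k ℕ.* M
  double = solve-∀

-- Comparing the bounds with the maximal ratio 10M / (3M + 1).

≤-via-+ : ∀ {m n} k → m ℕ.+ k ≡ n → m ≤ n
≤-via-+ {m} k refl = m≤m+n m k

-- The maximal ratio dominates each of the bounds on P (4 + m), for M = 2^m.
module _ (k : ℕ) where
  open ≤-Reasoning

  private
    -- With M = k + 1 the recurring slack 4M - 2 becomes `4 * k + 2`, so the inequalities with slack
    -- turn into polynomial identities over the natural numbers.
    M = suc k

    ratio₀ : ∀ k → 2 ℕ.* suc (3 ℕ.* suc k) ℕ.+ (4 ℕ.* k ℕ.+ 2) ≡ 10 ℕ.* suc k ℕ.* 1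
    ratio₀ = solve-∀

    ratio₁ : ∀ k → 4 ℕ.* suc (3 ℕ.* suc k) ℕ.+ (8 ℕ.* k ℕ.+ 4) ≡ 10 ℕ.* suc k ℕ.* 2
    ratio₁ = solve-∀

    ratio₂-left : ∀ p M → 3 ℕ.* (p ℕ.* suc (3 ℕ.* M)) ≡ 3 ℕ.* p ℕ.* suc (3 ℕ.* M)
    ratio₂-left = solve-∀

    ratio₂-mid : ∀ x M → 10 ℕ.* x ℕ.* suc (3 ℕ.* M) ≡ 30 ℕ.* (x ℕ.* M) ℕ.+ 10 ℕ.* x
    ratio₂-mid = solve-∀

    ratio₂-right : ∀ x M → 30 ℕ.* (x ℕ.* M) ℕ.+ 10 ℕ.* (3 ℕ.* M) ≡ 3 ℕ.* (10 ℕ.* M ℕ.* suc x)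
    ratio₂-right = solve-∀

    ratio₃ : ∀ k d → (2 ℕ.* (3 ℕ.* suc k ℕ.+ d) ℕ.+ 4 ℕ.* suc k) ℕ.* suc (3 ℕ.* suc k)
                     ℕ.+ d ℕ.* (4 ℕ.* k ℕ.+ 2) ≡ 10 ℕ.* suc k ℕ.* suc (3 ℕ.* suc k ℕ.+ d)
    ratio₃ = solve-∀

    ratio₄ : ∀ k d → 12 ℕ.* suc k ℕ.* suc (3 ℕ.* suc k)
                     ℕ.+ (suc k ℕ.* (4 ℕ.* k ℕ.+ 2) ℕ.+ 10 ℕ.* suc k ℕ.* d)
                     ≡ 10 ℕ.* suc k ℕ.* suc (4 ℕ.* suc k ℕ.+ d)
    ratio₄ = solve-∀

  ratio-≤-0 : ∀ p → p ≤ 2 → p ℕ.* suc (3 ℕ.* M) ≤ 10 ℕ.* M ℕ.* 1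
  ratio-≤-0 p p≤ = ≤-trans (*-monoˡ-≤ _ p≤) (≤-via-+ _ (ratio₀ k))

  ratio-≤-1 : ∀ p → p ≤ 4 → p ℕ.* suc (3 ℕ.* M) ≤ 10 ℕ.* M ℕ.* 2
  ratio-≤-1 p p≤ = ≤-trans (*-monoˡ-≤ _ p≤) (≤-via-+ _ (ratio₁ k))

  ratio-≤-short : ∀ p x → 3 ℕ.* p ≤ 10 ℕ.* x → x ≤ 3 ℕ.* M →
                  p ℕ.* suc (3 ℕ.* M) ≤ 10 ℕ.* M ℕ.* suc x
  ratio-≤-short p x p≤ x≤ = *-cancelˡ-≤ 3 (begin
    3 ℕ.* (p ℕ.* suc (3 ℕ.* M))             ≡⟨ ratio₂-left p M ⟩
    3 ℕ.* p ℕ.* suc (3 ℕ.* M)               ≤⟨ *-monoˡ-≤ _ p≤ ⟩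
    10 ℕ.* x ℕ.* suc (3 ℕ.* M)              ≡⟨ ratio₂-mid x M ⟩
    30 ℕ.* (x ℕ.* M) ℕ.+ 10 ℕ.* x           ≤⟨ +-monoʳ-≤ (30 ℕ.* (x ℕ.* M)) (*-monoʳ-≤ 10 x≤) ⟩
    30 ℕ.* (x ℕ.* M) ℕ.+ 10 ℕ.* (3 ℕ.* M)   ≡⟨ ratio₂-right x M ⟩
    3 ℕ.* (10 ℕ.* M ℕ.* suc x)              ∎)

  -- With x = 3M + d the slack is d(4M - 2), which vanishes exactly at the maximizing length.
  ratio-≤-middle : ∀ p x → p ≤ 2 ℕ.* x ℕ.+ 4 ℕ.* M → 3 ℕ.* M ≤ x →
                   p ℕ.* suc (3 ℕ.* M) ≤ 10 ℕ.* M ℕ.* suc x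
  ratio-≤-middle p x p≤ 3M≤x with d , refl ← m≤n⇒∃[o]m+o≡n 3M≤x =
    ≤-trans (*-monoˡ-≤ _ p≤) (≤-via-+ _ (ratio₃ k d))

  ratio-≤-long : ∀ p x → p ℕ.+ x ≤ 16 ℕ.* M → 4 ℕ.* M ≤ x →
                 p ℕ.* suc (3 ℕ.* M) ≤ 10 ℕ.* M ℕ.* suc x
  ratio-≤-long p x p+x≤ 4M≤x with d , refl ← m≤n⇒∃[o]m+o≡n 4M≤x =
    ≤-trans (*-monoˡ-≤ _ p≤12M) (≤-via-+ _ (ratio₄ k d))
    where
    p≤12M : p ≤ 12 ℕ.* M
    p≤12M = +-cancelʳ-≤ (4 ℕ.* M) p (12 ℕ.* M) (begin
      p ℕ.+ 4 ℕ.* M            ≤⟨ +-monoʳ-≤ p 4M≤x ⟩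
      p ℕ.+ x                  ≤⟨ p+x≤ ⟩
      16 ℕ.* M                 ≡⟨ *-distribʳ-+ M 12 4 ⟩
      12 ℕ.* M ℕ.+ 4 ℕ.* M     ∎)

2^4+m≡16·2^m : ∀ m → 2 ℕ.^ (4 ℕ.+ m) ≡ 16 ℕ.* 2 ℕ.^ m
2^4+m≡16·2^m m = ^-distribˡ-+-* 2 4 m

P-ratio-≤ : ∀ m x → x < 2 ℕ.^ (4 ℕ.+ m) →
  P (4 ℕ.+ m) x ℕ.* suc (3 ℕ.* 2 ℕ.^ m) ≤ 10 ℕ.* 2 ℕ.^ m ℕ.* suc x
P-ratio-≤ m x x<
  -- Abstracting the power together with the facts about it lets positivity expose it as `suc k`.
  -- The cases x = 0 and x = 1 are separate because the bound 10x/3 starts at x = 2.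
  with 2 ℕ.^ m | m^n>0 2 m | 2^4+m≡16·2^m m | P+x≤2^n (4 ℕ.+ m) x (<⇒≤ x<) | P≤2x+4·2^m m x
P-ratio-≤ m 0 _ | suc k | _ | _ | _ | _ = ratio-≤-0 k (P (4 ℕ.+ m) 0) (P-0-≤ (4 ℕ.+ m))
P-ratio-≤ m 1 _ | suc k | _ | _ | _ | _ = ratio-≤-1 k (P (4 ℕ.+ m) 1) (P-1-≤ (4 ℕ.+ m))
P-ratio-≤ m x@(suc (suc _)) x< | suc k | _ | 2^≡ | long | middle
  with x ≤? 3 ℕ.* suc k | x ≤? 4 ℕ.* suc k
... | yes x≤ | _      = ratio-≤-short k (P (4 ℕ.+ m) x) x (3P≤10x (4 ℕ.+ m) x (s≤s (s≤s z≤n)) (<⇒≤ x<)) x≤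
... | no x≰  | yes x≤ = ratio-≤-middle k (P (4 ℕ.+ m) x) x (middle x≤) (≰⇒≥ x≰)
... | no _   | no x≰  = ratio-≤-long k (P (4 ℕ.+ m) x) x (≤-trans long (≤-reflexive 2^≡)) (≰⇒≥ x≰)

-- Rational arithmetic for the closed form.

/-mono-≤ : ∀ p d p′ d′ → p ℕ.* suc d′ ≤ p′ ℕ.* suc d → + p / suc d ℚ.≤ + p′ / suc d′
-- Since `/` reduces fractions, the comparison passes to unnormalised rationals, where it is plain
-- cross-multiplication.
/-mono-≤ p d p′ d′ le = ℚₚ.toℚᵘ-cancel-≤ (begin
  ℚ.toℚᵘ (+ p / suc d)      ≃⟨ ℚₚ.toℚᵘ-fromℚᵘ (ℚᵘ.mkℚᵘ (+ p) d) ⟩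
  ℚᵘ.mkℚᵘ (+ p) d           ≤⟨ ℚᵘ.*≤* (subst₂ ℤ._≤_ (ℤₚ.pos-* p (suc d′)) (ℤₚ.pos-* p′ (suc d)) (ℤ.+≤+ le)) ⟩
  ℚᵘ.mkℚᵘ (+ p′) d′         ≃⟨ ℚₚ.toℚᵘ-fromℚᵘ (ℚᵘ.mkℚᵘ (+ p′) d′) ⟨
  ℚ.toℚᵘ (+ p′ / suc d′)    ∎)
  where open ℚᵘₚ.≤-Reasoning

-- Here 3 + 1/M = (3M + 1)/M, which cancels the denominator; this matches 10M / (3M + 1) with the
-- stated quotient.
/-*-+1/ : ∀ M .{{_ : ℕ.NonZero M}} →
  (+ (10 ℕ.* M) / suc (3 ℕ.* M)) ℚ.* (+ 3 / 1 + + 1 / M) ≡ + 10 / 1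
/-*-+1/ M@(suc d) = ℚₚ.toℚᵘ-injective (begin
  ℚ.toℚᵘ (s ℚ.* (+ 3 / 1 + + 1 / M))                    ≈⟨ ℚₚ.toℚᵘ-homo-* s (+ 3 / 1 + + 1 / M) ⟩
  ℚ.toℚᵘ s ℚᵘ.* ℚ.toℚᵘ (+ 3 / 1 + + 1 / M)              ≈⟨ ℚᵘₚ.*-cong (ℚₚ.toℚᵘ-fromℚᵘ sᵘ) (ℚₚ.toℚᵘ-homo-+ (+ 3 / 1) (+ 1 / M)) ⟩
  sᵘ ℚᵘ.* (ℚᵘ.mkℚᵘ (+ 3) 0 ℚᵘ.+ ℚ.toℚᵘ (+ 1 / M))       ≈⟨ ℚᵘₚ.*-congˡ {sᵘ} (ℚᵘₚ.+-congʳ (ℚᵘ.mkℚᵘ (+ 3) 0) (ℚₚ.toℚᵘ-fromℚᵘ (ℚᵘ.mkℚᵘ (+ 1) d))) ⟩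
  sᵘ ℚᵘ.* (ℚᵘ.mkℚᵘ (+ 3) 0 ℚᵘ.+ ℚᵘ.mkℚᵘ (+ 1) d)        ≈⟨ ℚᵘ.*≡* (cong +_ (cross d)) ⟩
  ℚᵘ.mkℚᵘ (+ 10) 0                                      ∎)
  where
  open import Relation.Binary.Reasoning.Setoid ℚᵘₚ.≃-setoid
  s = + (10 ℕ.* M) / suc (3 ℕ.* M)
  sᵘ = ℚᵘ.mkℚᵘ (+ (10 ℕ.* M)) (3 ℕ.* M)

  cross : ∀ d → 10 ℕ.* suc d ℕ.* (3 ℕ.* suc d ℕ.+ 1) ℕ.* 1
              ≡ 10 ℕ.* (suc (3 ℕ.* suc d) ℕ.* (1 ℕ.* suc d))
  cross = solve-∀

≡-÷ : ∀ {p q s} .{{_ : ℚ.NonZero q}} → s ℚ.* q ≡ p → s ≡ p ÷ q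
≡-÷ {q = q} {s} refl = begin
  s                        ≡⟨ ℚₚ.*-identityʳ s ⟨
  s ℚ.* ℚ.1ℚ               ≡⟨ cong (s ℚ.*_) (ℚₚ.*-inverseʳ q) ⟨
  s ℚ.* (q ℚ.* ℚ.1/ q)     ≡⟨ ℚₚ.*-assoc s q (ℚ.1/ q) ⟨
  s ℚ.* q ÷ q              ∎
  where open ≡-Reasoning

-- The split on `m` follows the two clauses of `2^_`: the exponent is zero for m = 0 and negative
-- afterwards.
2^[4-[4+m]] : ∀ m → 2^ (+ 4 - + (4 ℕ.+ m)) ≡ (+ 1 / (2 ℕ.^ m)) {{m^n≢0 2 m}}
2^[4-[4+m]] zero    = refl
2^[4-[4+m]] (suc m) = refl

-- Evaluating the maximum.

δ-≡ : ∀ w {r} → ℚ.0ℚ ℚ.≤ r →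
  (∀ {i} → i < length w → + #substr w (suc i) / suc i ℚ.≤ r) →
  (∃ λ i → i < length w × r ℚ.≤ + #substr w (suc i) / suc i) →
  δ w ≡ r
δ-≡ w {r} 0≤r upper (i , i< , lower) = ℚₚ.≤-antisym
  -- The assumption `0≤r` takes care of the default value of `max`.
  (max≤v⁺ 0≤r (All.map⁺ (All.tabulate (λ i∈ → upper (∈-upTo⁻ i∈)))))
  (v≤max⁺ ℚ.0ℚ (map ratio (upTo (length w))) (inj₂ (Any.map⁺ (lose (∈-upTo⁺ i<) lower))))
  where
  ratio : ℕ → ℚ.ℚ
  ratio i = + #substr w (suc i) / suc i

δ-t[4+m] : ∀ m → δ (t (4 ℕ.+ m)) ≡ + (10 ℕ.* 2 ℕ.^ m) / suc (3 ℕ.* 2 ℕ.^ m)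
δ-t[4+m] m = δ-≡ (t (4 ℕ.+ m)) (/-mono-≤ 0 0 (10 ℕ.* M) (3 ℕ.* M) z≤n)
  (λ {i} i< → /-mono-≤ (P (4 ℕ.+ m) i) i (10 ℕ.* M) (3 ℕ.* M)
                (P-ratio-≤ m i (subst (i <_) (length-t (4 ℕ.+ m)) i<)))
  (3 ℕ.* M , 3M< ,
   /-mono-≤ (10 ℕ.* M) (3 ℕ.* M) (P (4 ℕ.+ m) (3 ℕ.* M)) (3 ℕ.* M)
     (*-monoˡ-≤ (suc (3 ℕ.* M)) (10·2^m≤P m)))
  where
  M = 2 ℕ.^ m

  3M< : 3 ℕ.* M < length (t (4 ℕ.+ m))
  3M< = begin-strict
    -- The inequality 3 < 16 is supplied as 4 ≤ 4 + 12.
    3 ℕ.* M                  <⟨ *-monoˡ-< M {{m^n≢0 2 m}} (m≤m+n 4 12) ⟩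
    16 ℕ.* M                 ≡⟨ 2^4+m≡16·2^m m ⟨
    2 ℕ.^ (4 ℕ.+ m)          ≡⟨ length-t (4 ℕ.+ m) ⟨
    length (t (4 ℕ.+ m))     ∎
    where open ≤-Reasoning

theorem4 : ∀ (n : ℕ) →
    (n ≡ 0 → δ (t n) ≡ + 1 / 1) ×
    (n ≡ 1 ⊎ n ≡ 2 → δ (t n) ≡ + 2 / 1) ×
    (n ≥ 3 → δ (t n) ≡ ((+ 10 / 1) ÷ (+ 3 / 1 + 2^ (+ 4 - + n))) {{3+2^-nonZero (+ 4 - + n)}})
theorem4 n = (λ { refl → refl }) , (λ { (inj₁ refl) → refl ; (inj₂ refl) → refl }) , large n
  where
  large : ∀ n → n ≥ 3 →
    δ (t n) ≡ ((+ 10 / 1) ÷ (+ 3 / 1 + 2^ (+ 4 - + n))) {{3+2^-nonZero (+ 4 - + n)}}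
  large 1 (s≤s ())
  large 2 (s≤s (s≤s ()))
  -- Here M would be 1/2, so this case is evaluated: both sides are 2.
  large 3 _ = refl
  large (suc (suc (suc (suc m)))) _ = trans (δ-t[4+m] m)
    (≡-÷ {{3+2^-nonZero (+ 4 - + (4 ℕ.+ m))}}
      (trans (cong (λ e → (+ (10 ℕ.* 2 ℕ.^ m) / suc (3 ℕ.* 2 ℕ.^ m)) ℚ.* (+ 3 / 1 + e)) (2^[4-[4+m]] m))
             (/-*-+1/ (2 ℕ.^ m) {{m^n≢0 2 m}})))
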